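{- If computability is stable over the field $\langle K,+,\times\rangle$, and the field $\langle L,+,\times\rangle$ is an extension of finite degree of $\langle K,+,\times\rangle$, then computability is stable over the structure $\langle K,L,+,\times,+,.,\times\rangle$.
   Context: Computability over natural numbers is the usual one. A set $A \subseteq \mathbb{N}$ is effectively enumerable if it is empty or the image of a total computable function from $\mathbb{N}$ to $\mathbb{N}$. For $A \subseteq \mathbb{N}^m$ and $B \subseteq \mathbb{N}$, a computable function from $A$ to $B$ is a partial computable function that is defined at every element of $A$ and takes values in $B$ there. Indexing: an indexing of a set $E$ is a partial function $i$ from $\mathbb{N}$ to $E$ such that $dom(i)$ is effectively enumerable, $i$ is surjective, and there is a computable function $eq$ from $dom(i)\times dom(i)$ to $\{0,1\}$ with $eq(x,y)=1$ if $i(x)=i(y)$ and $eq(x,y)=0$ otherwise. An indexing of a family of sets $E_1,\ldots,E_n$ is a family $i_1,\ldots,i_n$ of indexings of $E_1,\ldots,E_n$. Computable function: given sets $E_1,\ldots,E_m,E_{m+1}$ with indexings $i_1,\ldots,i_{m+1}$, a function $f: E_1\times\ldots\times E_m \to E_{m+1}$ is computable relatively to this indexing if there is a computable function $\hat f$ from $dom(i_1)\times\ldots\times dom(i_m)$ to $dom(i_{m+1})$ such that $i_{m+1}(\hat f(x_1,\ldots,x_m)) = f(i_1(x_1),\ldots,i_m(x_m))$ for all $x_k \in dom(i_k)$. Admissible indexing: a structure $\langle E_1,\ldots,E_n,op_1,\ldots,op_p\rangle$ consists of sets $E_1,\ldots,E_n$ and operations, each from a product of some of these sets to one of these sets. An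 indexing of it is an indexing of $E_1,\ldots,E_n$; it is admissible if every $op_k$ is computable relatively to the indexings of its domains and co-domain. Stable computability: computability is stable over $\langle E_1,\ldots,E_n,op_1,\ldots,op_p\rangle$ if there exists an admissible indexing of this structure and, for all admissible indexings $j_1,\ldots,j_n$ and $j'_1,\ldots,j'_n$ of it, there exist computable functions $h_k$ from $dom(j'_k)$ to $dom(j_k)$ such that $j'_k = j_k\circ h_k$, for $k=1,\ldots,n$. The two-sorted structure $\langle K,L,+,\times,+,.,\times\rangle$ has as operations the addition and multiplication of $K$, the addition of $L$, the product $.$ of an element of $L$ by an element of $K$, and the multiplication of $L$. -}

module Defs where

open import Algebra.Bundles using (CommutativeRing)
open import Algebra.Definitions using (Invertible)
open import Algebra.Definitions.RawMonoid using (sum)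
open import Algebra.Morphism.Structures using (module RingMorphisms)
open import Data.Fin.Base using (Fin; zero; suc)
open import Data.Nat.Base using (ℕ; zero; suc; _<_)
open import Data.Product.Base using (Σ; ∃; _×_; _,_)
open import Data.Sum.Base using (_⊎_)
open import Data.Vec.Base using (Vec; []; _∷_; lookup)
open import Function.Bundles using (_⇔_)
open import Level using (0ℓ; _⊔_) renaming (suc to lsuc)
open import Relation.Binary.Bundles using (Setoid)
open import Relation.Binary.PropositionalEquality using (_≡_)
open import Relation.Nullary.Negation using (¬_)
open import Relation.Unary using (Pred; _∈_; U; Empty)

data PR : ℕ → Set where
  zer  : ∀ {m} → PR m
  succ : PR 1
  proj : ∀ {m} → Fin m → PR m
  comp : ∀ {m k} → PR k → (Fin k → PR m) → PR m
  prec : ∀ {m} → PR m → PR (suc (suc m)) → PR (suc m)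
  μ    : ∀ {m} → PR (suc m) → PR m

infix 4 _[_]⇓_

-- f [ xs ]⇓ y : the partial function f is defined at xs, with value y.
data _[_]⇓_ : ∀ {m} → PR m → Vec ℕ m → ℕ → Set where
  ⇓zer   : ∀ {m} {xs : Vec ℕ m} → zer [ xs ]⇓ 0
  ⇓succ  : ∀ {x} → succ [ x ∷ [] ]⇓ suc x
  ⇓proj  : ∀ {m} {xs : Vec ℕ m} (i : Fin m) → proj i [ xs ]⇓ lookup xs i
  ⇓comp  : ∀ {m k} {f : PR k} {gs : Fin k → PR m} {xs : Vec ℕ m} {z : ℕ}
           (ys : Vec ℕ k) → (∀ i → gs i [ xs ]⇓ lookup ys i) →
           f [ ys ]⇓ z → comp f gs [ xs ]⇓ z
  ⇓prec₀ : ∀ {m} {f : PR m} {g : PR (suc (suc m))} {xs : Vec ℕ m} {y : ℕ} →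
           f [ xs ]⇓ y → prec f g [ 0 ∷ xs ]⇓ y
  ⇓precₛ : ∀ {m} {f : PR m} {g : PR (suc (suc m))} {xs : Vec ℕ m} {n r y : ℕ} →
           prec f g [ n ∷ xs ]⇓ r → g [ n ∷ r ∷ xs ]⇓ y →
           prec f g [ suc n ∷ xs ]⇓ y
  ⇓μ     : ∀ {m} {f : PR (suc m)} {xs : Vec ℕ m} {y : ℕ} →
           f [ y ∷ xs ]⇓ 0 →
           (∀ z → z < y → ∃ λ w → f [ z ∷ xs ]⇓ suc w) →
           μ f [ xs ]⇓ y

-- A computable function from A to B may also be defined outside A, where
-- nothing is required of it.
record ComputableFn {m : ℕ} (A : Pred (Vec ℕ m) 0ℓ) (B : Pred ℕ 0ℓ) : Set where
  field
    code     : PR m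
    value    : ∀ xs → xs ∈ A → ℕ
    computes : ∀ xs (p : xs ∈ A) → code [ xs ]⇓ value xs p
    value∈   : ∀ xs (p : xs ∈ A) → value xs p ∈ B

∏ : ∀ {m} → (Fin m → Pred ℕ 0ℓ) → Pred (Vec ℕ m) 0ℓ
∏ D xs = ∀ k → lookup xs k ∈ D k

EffectivelyEnumerable : Pred ℕ 0ℓ → Set
EffectivelyEnumerable A =
  Empty A ⊎
  Σ (ComputableFn {1} U U) λ f →
    ∀ x → x ∈ A ⇔ (∃ λ n → ComputableFn.value f (n ∷ []) _ ≡ x)

-- Sets are setoids: equality of elements is the setoid equality.  The
-- partial function ℕ ⇀ E is given by its domain and a map on the domain
-- which does not depend on the proof of membership.
record Indexing {c ℓ} (E : Setoid c ℓ) : Set (lsuc 0ℓ ⊔ c ⊔ ℓ) where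
  open Setoid E
  field
    dom            : Pred ℕ 0ℓ
    app            : ∀ x → x ∈ dom → Carrier
    app-irrelevant : ∀ x (p q : x ∈ dom) → app x p ≈ app x q
    dom-enumerable : EffectivelyEnumerable dom
    surjective     : ∀ e → ∃ λ x → Σ (x ∈ dom) λ p → app x p ≈ e
    eq             : ComputableFn (∏ {2} λ _ → dom) (λ y → y ≡ 0 ⊎ y ≡ 1)

  private
    module eq = ComputableFn eq

  -- The disjunction says "1 if equal, 0 otherwise" without assuming
  -- excluded middle for _≈_.
  field
    eq-correct : ∀ xs (p : xs ∈ ∏ {2} λ _ → dom) →
      let a = app (lookup xs zero) (p zero)
          b = app (lookup xs (suc zero)) (p (suc zero))
      in (a ≈ b × eq.value xs p ≡ 1) ⊎ (¬ a ≈ b × eq.value xs p ≡ 0)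

record Operation {c ℓ n} (E : Fin n → Setoid c ℓ) : Set (c ⊔ ℓ) where
  field
    arity  : ℕ
    source : Fin arity → Fin n
    target : Fin n

  private
    module E s = Setoid (E s)

  field
    op      : (∀ k → E.Carrier (source k)) → E.Carrier target
    op-cong : ∀ {as bs : ∀ k → E.Carrier (source k)} →
              (∀ k → E._≈_ (source k) (as k) (bs k)) →
              E._≈_ target (op as) (op bs)

record Structure c ℓ : Set (lsuc (c ⊔ ℓ)) where
  field
    sorts      : ℕ
    E          : Fin sorts → Setoid c ℓ
    #ops       : ℕ
    operations : Fin #ops → Operation E

module _ {c ℓ n} {E : Fin n → Setoid c ℓ} where

  open Indexing

  record ComputableOp (i : ∀ s → Indexing (E s)) (o : Operation E) : Set (c ⊔ ℓ) where
    open Operation o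
    field
      f̂ : ComputableFn (∏ λ k → dom (i (source k))) (dom (i target))
    open ComputableFn f̂
    field
      commutes : ∀ xs (p : xs ∈ ∏ (λ k → dom (i (source k)))) →
        Setoid._≈_ (E target)
          (app (i target) (value xs p) (value∈ xs p))
          (op λ k → app (i (source k)) (lookup xs k) (p k))

record AdmissibleIndexing {c ℓ} (S : Structure c ℓ) : Set (lsuc 0ℓ ⊔ c ⊔ ℓ) where
  open Structure S
  field
    indexing   : ∀ s → Indexing (E s)
    admissible : ∀ k → ComputableOp indexing (operations k)

record _ReducesTo_ {c ℓ} {E : Setoid c ℓ} (j′ j : Indexing E) : Set (c ⊔ ℓ) where
  private
    module J  = Indexing j
    module J′ = Indexing j′
  open Setoid E using (_≈_)
  field
    h : ComputableFn {1} (∏ λ _ → J′.dom) J.dom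
  open ComputableFn h
  field
    factors : ∀ xs (p : xs ∈ ∏ {1} λ _ → J′.dom) →
      J′.app (lookup xs zero) (p zero) ≈ J.app (value xs p) (value∈ xs p)

record Stable {c ℓ} (S : Structure c ℓ) : Set (lsuc 0ℓ ⊔ c ⊔ ℓ) where
  open AdmissibleIndexing
  field
    existence  : AdmissibleIndexing S
    uniqueness : ∀ (j j′ : AdmissibleIndexing S) s →
                 indexing j′ s ReducesTo indexing j s

record Field c ℓ : Set (lsuc (c ⊔ ℓ)) where
  field
    commutativeRing : CommutativeRing c ℓ
  open CommutativeRing commutativeRing public
  field
    0≉1        : ¬ 0# ≈ 1#
    invertible : ∀ x → ¬ x ≈ 0# → Invertible _≈_ 1# _*_ x

record Extension {c ℓ} (K L : Field c ℓ) : Set (c ⊔ ℓ) where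
  private
    module K = Field K
    module L = Field L
  open RingMorphisms K.rawRing L.rawRing using (IsRingMonomorphism)
  field
    ι                  : K.Carrier → L.Carrier
    isRingMonomorphism : IsRingMonomorphism ι
  open IsRingMonomorphism isRingMonomorphism public using (⟦⟧-cong)

  infixr 7 _·_
  _·_ : K.Carrier → L.Carrier → L.Carrier
  k · l = ι k L.* l

  linComb : ∀ {n} → (Fin n → K.Carrier) → (Fin n → L.Carrier) → L.Carrier
  linComb ks ls = sum L.+-rawMonoid λ i → ks i · ls i

record FiniteDegree {c ℓ} {K L : Field c ℓ} (ext : Extension K L) : Set (c ⊔ ℓ) where
  private
    module K = Field K
    module L = Field L
  open Extension ext
  field
    degree      : ℕ
    basis       : Fin degree → L.Carrier
    spanning    : ∀ l → ∃ λ ks → l L.≈ linComb ks basis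
    independent : ∀ ks → linComb ks basis L.≈ L.0# → ∀ i → ks i K.≈ K.0#

module _ {c ℓ n} (E : Fin n → Setoid c ℓ) where

  private
    module E s = Setoid (E s)

  binary : ∀ s t u (_∙_ : E.Carrier s → E.Carrier t → E.Carrier u) →
           (∀ {x x′ y y′} → E._≈_ s x x′ → E._≈_ t y y′ → E._≈_ u (x ∙ y) (x′ ∙ y′)) →
           Operation E
  binary s t u _∙_ ∙-cong = record
    { arity   = 2
    ; source  = lookup (s ∷ t ∷ [])
    ; target  = u
    ; op      = λ as → as zero ∙ as (suc zero)
    ; op-cong = λ as≈bs → ∙-cong (as≈bs zero) (as≈bs (suc zero))
    }

fieldStructure : ∀ {c ℓ} → Field c ℓ → Structure c ℓ
fieldStructure {c} {ℓ} K = record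
  { sorts      = 1
  ; E          = E
  ; #ops       = 2
  ; operations = lookup
      ( binary E zero zero zero K._+_ K.+-cong
      ∷ binary E zero zero zero K._*_ K.*-cong
      ∷ [])
  }
  where
  module K = Field K

  E : Fin 1 → Setoid c ℓ
  E _ = K.setoid

extensionStructure : ∀ {c ℓ} {K L : Field c ℓ} → Extension K L → Structure c ℓ
extensionStructure {c} {ℓ} {K} {L} ext = record
  { sorts      = 2
  ; E          = E
  ; #ops       = 5
  ; operations = lookup
      ( binary E k k k K._+_ K.+-cong
      ∷ binary E k k k K._*_ K.*-cong
      ∷ binary E l l l L._+_ L.+-cong
      ∷ binary E k l l _·_ (λ a≈b x≈y → L.*-cong (⟦⟧-cong a≈b) x≈y)
      ∷ binary E l l l L._*_ L.*-cong
      ∷ [])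
  }
  where
  module K = Field K
  module L = Field L
  open Extension ext

  pattern k = zero
  pattern l = suc zero

  E : Fin 2 → Setoid c ℓ
  E k = K.setoid
  E l = L.setoid

-- Every indexing of an inhabited set can be replaced by one with domain ℕ: compose it with an
-- enumeration of its domain; the two reduce to each other, an index being located in the
-- enumeration by minimisation over eq.  Given such an indexing ν of K, the code of a tuple
-- (z₁,…,zₙ) is taken as an index of Σ ν(zᵢ)·bᵢ, where b is a basis of L; products in L are
-- computed from indices of the finitely many elements bᵢbⱼ.  For uniqueness, the coordinates
-- of an element given by the first indexing are found by exhaustive search, translated by
-- the stability of K, and recombined in the second indexing.
module Submission where

open import Defs

open import Algebra.Morphism.Structures using (module RingMorphisms)
import Algebra.Properties.Group as GroupProperties
import Algebra.Properties.Semiring.Sum as SemiringSum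
open import Data.Fin.Base using (Fin; zero; suc)
open import Data.Nat.Base using (ℕ; zero; suc; pred; _+_; _∸_; _≤_; _<_; z≤n; s≤s; s≤s⁻¹)
open import Data.Nat.Properties
  using (<-cmp; <⇒≱; ≤-trans; ≤-reflexive; m≤m+n; +-comm; +-monoʳ-≤; +-mono-≤;
         m≤n⇒m∸n≡0; m∸n≡0⇒m≤n; m+n∸m≡n; pred[m∸n]≡m∸[1+n])
open import Data.Product.Base using (Σ; ∃; _×_; _,_; proj₁; proj₂)
open import Data.Sum.Base using (_⊎_; inj₁; inj₂)
open import Data.Vec.Base using (Vec; []; _∷_; lookup)
open import Function.Base using (_∘_)
open import Function.Bundles using (_⇔_; mk⇔; module Equivalence)
open import Level using (Level; _⊔_)
open import Relation.Binary.Bundles using (Setoid)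
open import Relation.Binary.Definitions using (tri<; tri≈; tri>)
open import Relation.Binary.PropositionalEquality
  using (_≡_; _≢_; refl; sym; trans; cong; cong₂; subst)
import Relation.Binary.Reasoning.Setoid as SetoidReasoning
open import Relation.Nullary.Negation using (¬_; contradiction)
open import Relation.Unary using (_∈_; U)

private
  variable
    c ℓ : Level
    m n : ℕ

comp₁ : PR 1 → PR m → PR m
comp₁ f g = comp f (λ _ → g)

comp₂ : PR 2 → PR m → PR m → PR m
comp₂ f g h = comp f (lookup (g ∷ h ∷ []))

⇓comp₁ : ∀ {f : PR 1} {g : PR m} {xs y z} →
         g [ xs ]⇓ y → f [ y ∷ [] ]⇓ z → comp₁ f g [ xs ]⇓ z
⇓comp₁ g⇓ f⇓ = ⇓comp (_ ∷ []) (λ { zero → g⇓ }) f⇓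

⇓comp₂ : ∀ {f : PR 2} {g h : PR m} {xs y y′ z} →
         g [ xs ]⇓ y → h [ xs ]⇓ y′ → f [ y ∷ y′ ∷ [] ]⇓ z →
         comp₂ f g h [ xs ]⇓ z
⇓comp₂ g⇓ h⇓ f⇓ = ⇓comp (_ ∷ _ ∷ []) (λ { zero → g⇓ ; (suc zero) → h⇓ }) f⇓

⇓μ-least : ∀ {f : PR (suc m)} {xs} (F : ℕ → ℕ) → (∀ y → f [ y ∷ xs ]⇓ F y) →
           (∃ λ y → F y ≡ 0) →
           ∃ λ y → μ f [ xs ]⇓ y × F y ≡ 0 × (∀ z → z < y → F z ≢ 0)
⇓μ-least {f = f} {xs} F f⇓ (b , Fb≡0) =
  let y , Fy≡0 , below = least F b Fb≡0
  in y , ⇓μ (subst (f [ y ∷ xs ]⇓_) Fy≡0 (f⇓ y)) (λ z z<y → positive z (below z z<y)) , Fy≡0 , below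
  where
  least : ∀ (F : ℕ → ℕ) b → F b ≡ 0 → ∃ λ y → F y ≡ 0 × (∀ z → z < y → F z ≢ 0)
  least F zero F0≡0 = 0 , F0≡0 , λ _ ()
  least F (suc b) Fb≡0 with F 0 in F0≡
  ... | zero  = 0 , F0≡ , λ _ ()
  ... | suc _ =
    let y , Fy≡0 , below = least (F ∘ suc) b Fb≡0
    in suc y , Fy≡0 , λ
      { zero    _   F0≡0 → contradiction (trans (sym F0≡) F0≡0) λ ()
      ; (suc z) z<y      → below z (s≤s⁻¹ z<y) }

  positive : ∀ z → F z ≢ 0 → ∃ λ w → f [ z ∷ xs ]⇓ suc w
  positive z Fz≢0 with F z | f⇓ z
  ... | zero  | _  = contradiction refl Fz≢0
  ... | suc w | f⇓ = w , f⇓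

record Computable (F : Vec ℕ m → ℕ) : Set where
  constructor computable
  field
    code     : PR m
    computes : ∀ xs → code [ xs ]⇓ F xs

open Computable

Computable₁ : (ℕ → ℕ) → Set
Computable₁ f = Computable {1} λ xs → f (lookup xs zero)

Computable₂ : (ℕ → ℕ → ℕ) → Set
Computable₂ f = Computable {2} λ xs → f (lookup xs zero) (lookup xs (suc zero))

proj-computable : (i : Fin m) → Computable λ xs → lookup xs i
proj-computable i = computable (proj i) λ _ → ⇓proj i

suc-computable : Computable₁ suc
suc-computable = computable succ λ { (_ ∷ []) → ⇓succ }

apply₁ : ∀ {F : Vec ℕ 1 → ℕ} {G : Vec ℕ m → ℕ} →
         Computable F → Computable G → Computable λ xs → F (G xs ∷ [])
apply₁ f g = computable (comp₁ (code f) (code g)) λ xs →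
  ⇓comp₁ (computes g xs) (computes f _)

apply₂ : ∀ {F : Vec ℕ 2 → ℕ} {G H : Vec ℕ m → ℕ} →
         Computable F → Computable G → Computable H →
         Computable λ xs → F (G xs ∷ H xs ∷ [])
apply₂ f g h = computable (comp₂ (code f) (code g) (code h)) λ xs →
  ⇓comp₂ (computes g xs) (computes h xs) (computes f _)

const-computable : ∀ k → Computable {m} λ _ → k
const-computable zero    = computable zer λ _ → ⇓zer
const-computable (suc k) = apply₁ suc-computable (const-computable k)

prec-computable : ∀ {F : Vec ℕ m → ℕ} {G} {H : Vec ℕ (suc m) → ℕ} →
                  Computable F → Computable G →
                  (∀ xs → F xs ≡ H (0 ∷ xs)) →
                  (∀ k xs → G (k ∷ H (k ∷ xs) ∷ xs) ≡ H (suc k ∷ xs)) →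
                  Computable H
prec-computable {H = H} f g base step =
  computable h λ { (k ∷ xs) → h⇓ k xs }
  where
  h = prec (code f) (code g)

  h⇓ : ∀ k xs → h [ k ∷ xs ]⇓ H (k ∷ xs)
  h⇓ zero    xs = subst (h [ _ ]⇓_) (base xs) (⇓prec₀ (computes f xs))
  h⇓ (suc k) xs = subst (h [ _ ]⇓_) (step k xs) (⇓precₛ (h⇓ k xs) (computes g _))

minimisation : ∀ {F : Vec ℕ (suc m) → ℕ} → Computable F →
               (∀ xs → ∃ λ y → F (y ∷ xs) ≡ 0) →
               Σ (Vec ℕ m → ℕ) λ S → Computable S ×
                 (∀ xs → F (S xs ∷ xs) ≡ 0 × (∀ z → z < S xs → F (z ∷ xs) ≢ 0))
minimisation {F = F} f root =
  proj₁ ∘ least , computable (μ (code f)) (proj₁ ∘ proj₂ ∘ least) , proj₂ ∘ proj₂ ∘ least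
  where
  least = λ xs → ⇓μ-least {xs = xs} (λ y → F (y ∷ xs)) (λ y → computes f (y ∷ xs)) (root xs)

+-computable : Computable₂ _+_
+-computable =
  prec-computable (proj-computable zero)
    (apply₁ suc-computable (proj-computable (suc zero)))
    (λ _ → refl) (λ _ _ → refl)

pred-computable : Computable₁ pred
pred-computable =
  prec-computable (const-computable 0) (proj-computable zero) (λ _ → refl) (λ _ _ → refl)

∸-computable : Computable₂ _∸_
∸-computable = apply₂ flipped (proj-computable (suc zero)) (proj-computable zero)
  where
  flipped : Computable₂ λ k l → l ∸ k
  flipped =
    prec-computable (proj-computable zero)
      (apply₁ pred-computable (proj-computable (suc zero)))
      (λ _ → refl) (λ { k (l ∷ []) → pred[m∸n]≡m∸[1+n] l k })

isZero : ℕ → ℕ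
isZero zero    = 1
isZero (suc _) = 0

isZero-computable : Computable₁ isZero
isZero-computable =
  prec-computable (const-computable 1) (const-computable 0) (λ _ → refl) (λ _ _ → refl)

_and_ : ℕ → ℕ → ℕ
zero  and l = 0
suc _ and l = l

and-computable : Computable₂ _and_
and-computable =
  prec-computable (const-computable 0) (proj-computable (suc (suc zero)))
    (λ _ → refl) (λ _ _ → refl)

triangle : ℕ → ℕ
triangle zero    = 0
triangle (suc k) = suc k + triangle k

triangle-computable : Computable₁ triangle
triangle-computable =
  prec-computable (const-computable 0)
    (apply₁ suc-computable
      (apply₂ +-computable (proj-computable zero) (proj-computable (suc zero))))
    (λ _ → refl) (λ _ _ → refl)

triangle-mono : ∀ {k l} → k ≤ l → triangle k ≤ triangle l
triangle-mono z≤n       = z≤n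
triangle-mono (s≤s k≤l) = +-mono-≤ (s≤s k≤l) (triangle-mono k≤l)

pair : ℕ → ℕ → ℕ
pair a b = triangle (a + b) + a

-- The code z lies on the least diagonal d with z < triangle (suc d).
diagonal-search : Σ (Vec ℕ 1 → ℕ) λ S → Computable S ×
  (∀ xs → suc (lookup xs zero) ∸ triangle (suc (S xs)) ≡ 0 ×
    (∀ d → d < S xs → suc (lookup xs zero) ∸ triangle (suc d) ≢ 0))
diagonal-search =
  minimisation
    (apply₂ ∸-computable (apply₁ suc-computable (proj-computable (suc zero)))
      (apply₁ triangle-computable (apply₁ suc-computable (proj-computable zero))))
    (λ { (z ∷ []) → z , m≤n⇒m∸n≡0 (m≤m+n (suc z) (triangle z)) })

diagonal : ℕ → ℕ
diagonal z = proj₁ diagonal-search (z ∷ [])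

diagonal-computable : Computable₁ diagonal
diagonal-computable = computable (code S) λ { (z ∷ []) → computes S (z ∷ []) }
  where S = proj₁ (proj₂ diagonal-search)

diagonal-pair : ∀ a b → diagonal (pair a b) ≡ a + b
diagonal-pair a b with proj₂ (proj₂ diagonal-search) (pair a b ∷ [])
... | z<next , below with <-cmp (diagonal (pair a b)) (a + b)
... | tri≈ _ d≡a+b _ = d≡a+b
... | tri< d<a+b _ _ =
  contradiction (≤-trans (m∸n≡0⇒m≤n z<next) (triangle-mono d<a+b))
    (<⇒≱ (s≤s (m≤m+n (triangle (a + b)) a)))
... | tri> _ _ d>a+b = contradiction (m≤n⇒m∸n≡0 a+b-suffices) (below (a + b) d>a+b)
  where
  a+b-suffices : suc (pair a b) ≤ triangle (suc (a + b))
  a+b-suffices = s≤s (≤-trans (+-monoʳ-≤ (triangle (a + b)) (m≤m+n a b))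
    (≤-reflexive (+-comm (triangle (a + b)) (a + b))))

fst : ℕ → ℕ
fst z = z ∸ triangle (diagonal z)

snd : ℕ → ℕ
snd z = diagonal z ∸ fst z

fst-pair : ∀ a b → fst (pair a b) ≡ a
fst-pair a b =
  trans (cong (λ d → pair a b ∸ triangle d) (diagonal-pair a b)) (m+n∸m≡n (triangle (a + b)) a)

snd-pair : ∀ a b → snd (pair a b) ≡ b
snd-pair a b = trans (cong₂ _∸_ (diagonal-pair a b) (fst-pair a b)) (m+n∸m≡n a b)

pair-computable : Computable₂ pair
pair-computable =
  apply₂ +-computable (apply₁ triangle-computable +-computable) (proj-computable zero)

fst-computable : Computable₁ fst
fst-computable =
  apply₂ ∸-computable (proj-computable zero) (apply₁ triangle-computable diagonal-computable)

snd-computable : Computable₁ snd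
snd-computable = apply₂ ∸-computable diagonal-computable fst-computable

encode : ∀ n → (Fin n → ℕ) → ℕ
encode zero    as = 0
encode (suc n) as = pair (as zero) (encode n (as ∘ suc))

decode : Fin n → ℕ → ℕ
decode zero    z = fst z
decode (suc i) z = decode i (snd z)

decode-encode : ∀ (as : Fin n → ℕ) i → decode i (encode n as) ≡ as i
decode-encode {suc n} as zero    = fst-pair (as zero) (encode n (as ∘ suc))
decode-encode {suc n} as (suc i) =
  trans (cong (decode i) (snd-pair (as zero) (encode n (as ∘ suc)))) (decode-encode (as ∘ suc) i)

encode-computable : ∀ n {as : Fin n → Vec ℕ m → ℕ} → (∀ i → Computable (as i)) →
                    Computable λ xs → encode n (λ i → as i xs)
encode-computable zero    as = const-computable 0
encode-computable (suc n) as =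
  apply₂ pair-computable (as zero) (encode-computable n (as ∘ suc))

decode-computable : (i : Fin n) → Computable₁ (decode i)
decode-computable zero    = fst-computable
decode-computable (suc i) = apply₁ (decode-computable i) snd-computable

Decides : Set ℓ → ℕ → Set ℓ
Decides P b = (P × b ≡ 1) ⊎ (¬ P × b ≡ 0)

decides-0∨1 : ∀ {P : Set ℓ} {b} → Decides P b → b ≡ 0 ⊎ b ≡ 1
decides-0∨1 (inj₁ (_ , b≡1)) = inj₂ b≡1
decides-0∨1 (inj₂ (_ , b≡0)) = inj₁ b≡0

decides-map : ∀ {P Q : Set ℓ} {b} → (P → Q) → (Q → P) → Decides P b → Decides Q b
decides-map f g (inj₁ (p , b≡1))  = inj₁ (f p , b≡1)
decides-map f g (inj₂ (¬p , b≡0)) = inj₂ (¬p ∘ g , b≡0)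

isZero-decides : ∀ {P : Set ℓ} {b} → Decides P b → P ⇔ isZero b ≡ 0
isZero-decides (inj₁ (p , refl))  = mk⇔ (λ _ → refl) (λ _ → p)
isZero-decides (inj₂ (¬p , refl)) = mk⇔ (λ p → contradiction p ¬p) (λ ())

all : ∀ n → (Fin n → ℕ) → ℕ
all zero    bs = 1
all (suc n) bs = bs zero and all n (bs ∘ suc)

all-computable : ∀ n {bs : Fin n → Vec ℕ m → ℕ} → (∀ i → Computable (bs i)) →
                 Computable λ xs → all n (λ i → bs i xs)
all-computable zero    bs = const-computable 1
all-computable (suc n) bs = apply₂ and-computable (bs zero) (all-computable n (bs ∘ suc))

all-decides : ∀ n {P : Fin n → Set ℓ} {bs : Fin n → ℕ} →
              (∀ i → Decides (P i) (bs i)) → Decides (∀ i → P i) (all n bs)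
all-decides zero    _ = inj₁ ((λ ()) , refl)
all-decides (suc n) {bs = bs} d with bs zero | d zero
... | _ | inj₂ (¬p , refl) = inj₂ ((λ ps → ¬p (ps zero)) , refl)
... | _ | inj₁ (p , refl)  =
  decides-map (λ { ps zero → p ; ps (suc i) → ps i }) (λ ps i → ps (suc i))
    (all-decides n (d ∘ suc))

record Numbering (E : Setoid c ℓ) : Set (c ⊔ ℓ) where
  open Setoid E
  field
    ν             : ℕ → Carrier
    surjective    : ∀ e → ∃ λ x → ν x ≈ e
    eq            : Vec ℕ 2 → ℕ
    eq-computable : Computable eq
    eq-decides    : ∀ xs → Decides (ν (lookup xs zero) ≈ ν (lookup xs (suc zero))) (eq xs)

open Numbering using (ν)

fromNumbering : {E : Setoid c ℓ} → Numbering E → Indexing E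
fromNumbering {E = E} N = record
  { dom            = U
  ; app            = λ x _ → N.ν x
  ; app-irrelevant = λ _ _ _ → Setoid.refl E
  ; dom-enumerable = inj₂
      ( record
          { code     = proj zero
          ; value    = λ xs _ → lookup xs zero
          ; computes = λ _ _ → ⇓proj zero
          ; value∈   = _
          }
      , λ x → mk⇔ (λ _ → x , refl) _ )
  ; surjective     = λ e → let x , νx≈e = N.surjective e in x , _ , νx≈e
  ; eq             = record
      { code     = code N.eq-computable
      ; value    = λ xs _ → N.eq xs
      ; computes = λ xs _ → computes N.eq-computable xs
      ; value∈   = λ xs _ → decides-0∨1 (N.eq-decides xs)
      }
  ; eq-correct     = λ xs _ → N.eq-decides xs
  }
  where module N = Numbering N

record Tracked {E : Setoid c ℓ} (N : Numbering E) (f : Vec ℕ m → Setoid.Carrier E) :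
               Set ℓ where
  constructor tracked
  field
    {index}          : Vec ℕ m → ℕ
    index-computable : Computable index
    correct          : ∀ xs → Setoid._≈_ E (ν N (index xs)) (f xs)

Effective : {E₁ E₂ E₃ : Setoid c ℓ} (N₁ : Numbering E₁) (N₂ : Numbering E₂) (N₃ : Numbering E₃) →
            (Setoid.Carrier E₁ → Setoid.Carrier E₂ → Setoid.Carrier E₃) → Set ℓ
Effective N₁ N₂ N₃ _∙_ =
  Tracked {m = 2} N₃ λ xs → ν N₁ (lookup xs zero) ∙ ν N₂ (lookup xs (suc zero))

module _ {E : Setoid c ℓ} (N : Numbering E) where
  open Setoid E using (Carrier; _≈_)
  private module E = Setoid E

  tracked-const : ∀ e → Tracked {m = m} N λ _ → e
  tracked-const e =
    let x , νx≈e = Numbering.surjective N e in tracked (const-computable x) λ _ → νx≈e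

  tracked-index : ∀ {F : Vec ℕ m → ℕ} → Computable F → Tracked N (ν N ∘ F)
  tracked-index f = tracked f λ _ → E.refl

  tracked-resp : ∀ {f g : Vec ℕ m → Carrier} → (∀ xs → f xs ≈ g xs) → Tracked N f → Tracked N g
  tracked-resp f≈g (tracked F F≈f) = tracked F λ xs → E.trans (F≈f xs) (f≈g xs)

  search : ∀ {f g : Vec ℕ (suc m) → Carrier} → Tracked N f → Tracked N g →
           (∀ xs → ∃ λ z → f (z ∷ xs) ≈ g (z ∷ xs)) →
           Σ (Vec ℕ m → ℕ) λ S → Computable S × (∀ xs → f (S xs ∷ xs) ≈ g (S xs ∷ xs))
  search {f = f} {g} F G solvable =
    let S , S-computable , S-root = minimisation
          (apply₁ isZero-computable (apply₂ N.eq-computable F.index-computable G.index-computable))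
          (λ xs → let z , fz≈gz = solvable xs
                  in z , Equivalence.to (test (z ∷ xs)) fz≈gz)
    in S , S-computable , λ xs → Equivalence.from (test (S xs ∷ xs)) (proj₁ (S-root xs))
    where
    module N = Numbering N
    module F = Tracked F
    module G = Tracked G

    test : ∀ xs → f xs ≈ g xs ⇔ isZero (N.eq (F.index xs ∷ G.index xs ∷ [])) ≡ 0
    test xs = isZero-decides (decides-map
      (λ F≈G → E.trans (E.sym (F.correct xs)) (E.trans F≈G (G.correct xs)))
      (λ f≈g → E.trans (F.correct xs) (E.trans f≈g (E.sym (G.correct xs))))
      (N.eq-decides _))

tracked-op : {E₁ E₂ E₃ : Setoid c ℓ} {N₁ : Numbering E₁} {N₂ : Numbering E₂} {N₃ : Numbering E₃}
             {_∙_ : Setoid.Carrier E₁ → Setoid.Carrier E₂ → Setoid.Carrier E₃} →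
             (∀ {x x′ y y′} → Setoid._≈_ E₁ x x′ → Setoid._≈_ E₂ y y′ →
                Setoid._≈_ E₃ (x ∙ y) (x′ ∙ y′)) →
             Effective N₁ N₂ N₃ _∙_ →
             ∀ {f g} → Tracked {m = m} N₁ f → Tracked N₂ g → Tracked N₃ λ xs → f xs ∙ g xs
tracked-op {E₃ = E₃} ∙-cong (tracked OP OP≈) (tracked F F≈f) (tracked G G≈g) =
  tracked (apply₂ OP F G) λ xs → Setoid.trans E₃ (OP≈ _) (∙-cong (F≈f xs) (G≈g xs))

Reduction : {E : Setoid c ℓ} (N′ N : Numbering E) → Set ℓ
Reduction N′ N = Tracked {m = 1} N λ xs → ν N′ (lookup xs zero)

tracked-reduce : {E : Setoid c ℓ} {N′ N : Numbering E} → Reduction N′ N →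
                 ∀ {f : Vec ℕ m → Setoid.Carrier E} → Tracked N′ f → Tracked N f
tracked-reduce {E = E} (tracked H H≈) (tracked F F≈f) =
  tracked (apply₁ H F) λ xs → Setoid.trans E (H≈ _) (F≈f xs)

reduction : {E : Setoid c ℓ} {N′ N : Numbering E} →
            fromNumbering N′ ReducesTo fromNumbering N → Reduction N′ N
reduction {E = E} r = record
  { index            = λ xs → h.value (lookup xs zero ∷ []) _
  ; index-computable = computable h.code λ { (x ∷ []) → h.computes (x ∷ []) _ }
  ; correct          = λ xs → Setoid.sym E (factors (lookup xs zero ∷ []) _)
  }
  where
  open _ReducesTo_ r
  module h = ComputableFn h

module Totalisation {E : Setoid c ℓ} (j : Indexing E) (e₀ : Setoid.Carrier E) where

  open Setoid E using (Carrier; _≈_)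
  open Indexing j
  private
    module E = Setoid E
    module eq = ComputableFn eq

  record Enumeration : Set where
    field
      enum            : ℕ → ℕ
      enum-computable : Computable {1} λ xs → enum (lookup xs zero)
      enum∈dom        : ∀ n → enum n ∈ dom
      enum-onto       : ∀ x → x ∈ dom → ∃ λ n → enum n ≡ x

  enumeration : Enumeration
  enumeration with dom-enumerable
  ... | inj₁ empty =
    let x , x∈dom , _ = surjective e₀ in contradiction x∈dom (empty x)
  ... | inj₂ (f , image) = record
    { enum            = λ n → f.value (n ∷ []) _
    ; enum-computable = computable f.code λ { (n ∷ []) → f.computes (n ∷ []) _ }
    ; enum∈dom        = λ n → Equivalence.from (image _) (n , refl)
    ; enum-onto       = λ x → Equivalence.to (image x)
    }
    where module f = ComputableFn f

  open Enumeration enumeration public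

  both : ∀ {x y} → x ∈ dom → y ∈ dom → (x ∷ y ∷ []) ∈ ∏ {2} λ _ → dom
  both p q zero       = p
  both p q (suc zero) = q

  app-cong : ∀ {x y} (p : x ∈ dom) (q : y ∈ dom) → x ≡ y → app x p ≈ app y q
  app-cong p q refl = app-irrelevant _ p q

  enum-surjective : ∀ x (p : x ∈ dom) → ∃ λ n → app (enum n) (enum∈dom n) ≈ app x p
  enum-surjective x p =
    let n , enum≡x = enum-onto x p in n , app-cong (enum∈dom n) p enum≡x

  numbering : Numbering E
  numbering = record
    { ν             = λ n → app (enum n) (enum∈dom n)
    ; surjective    = λ e →
        let x , p , app≈e = surjective e
            n , ν≈app = enum-surjective x p
        in n , E.trans ν≈app app≈e
    ; eq            = λ xs → eq.value _ (in-dom xs)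
    ; eq-computable = computable
        (comp₂ eq.code (comp₁ (code enum-computable) (proj zero))
                       (comp₁ (code enum-computable) (proj (suc zero))))
        λ xs → ⇓comp₂ (⇓comp₁ (⇓proj zero) (computes enum-computable _))
                      (⇓comp₁ (⇓proj (suc zero)) (computes enum-computable _))
                      (eq.computes _ (in-dom xs))
    ; eq-decides    = λ xs → eq-correct _ (in-dom xs)
    }
    where
    in-dom : ∀ (xs : Vec ℕ 2) →
             (enum (lookup xs zero) ∷ enum (lookup xs (suc zero)) ∷ []) ∈ ∏ {2} λ _ → dom
    in-dom xs = both (enum∈dom _) (enum∈dom _)

  locateCode : PR 1
  locateCode =
    μ (comp₁ (code isZero-computable)
        (comp₂ eq.code (comp₁ (code enum-computable) (proj zero)) (proj (suc zero))))

  locate : ∀ x (p : x ∈ dom) →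
           ∃ λ n → locateCode [ x ∷ [] ]⇓ n × ν numbering n ≈ app x p
  locate x p =
    let n , ⇓n , hit , _ = ⇓μ-least (λ n → isZero (test n))
          (λ n → ⇓comp₁ (⇓comp₂ (⇓comp₁ (⇓proj zero) (computes enum-computable _))
                                 (⇓proj (suc zero))
                                 (eq.computes _ (both (enum∈dom n) p)))
                         (computes isZero-computable _))
          (let n , ν≈app = enum-surjective x p in n , Equivalence.to (test-correct n) ν≈app)
    in n , ⇓n , Equivalence.from (test-correct n) hit
    where
    test : ℕ → ℕ
    test n = eq.value _ (both (enum∈dom n) p)

    test-correct : ∀ n → ν numbering n ≈ app x p ⇔ isZero (test n) ≡ 0
    test-correct n = isZero-decides (eq-correct _ (both (enum∈dom n) p))

open Totalisation using (numbering)

reducesTo : {E : Setoid c ℓ} (j′ j : Indexing E) (e₀ : Setoid.Carrier E) →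
            Reduction (numbering j′ e₀) (numbering j e₀) → j′ ReducesTo j
reducesTo {E = E} j′ j e₀ r = record
  { h = record
      { code     = comp₁ (code J.enum-computable) (comp₁ (code r.index-computable) J′.locateCode)
      ; value    = λ xs p → J.enum (r.index (index′ xs p ∷ []))
      ; computes = λ { (x ∷ []) p → ⇓comp₁
          (⇓comp₁ (proj₁ (proj₂ (J′.locate x (p zero)))) (computes r.index-computable _))
          (computes J.enum-computable _) }
      ; value∈   = λ xs p → J.enum∈dom _
      }
  ; factors = λ xs p → E.sym (E.trans (r.correct _) (proj₂ (proj₂ (J′.locate _ (p zero)))))
  }
  where
  module E = Setoid E
  module J = Totalisation j e₀
  module J′ = Totalisation j′ e₀
  module r = Tracked r
  index′ : ∀ xs → xs ∈ ∏ {1} (λ _ → Indexing.dom j′) → ℕ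
  index′ xs p = proj₁ (J′.locate (lookup xs zero) (p zero))

module _ {E : Fin n → Setoid c ℓ} (s t u : Fin n)
         (_∙_ : Setoid.Carrier (E s) → Setoid.Carrier (E t) → Setoid.Carrier (E u))
         (∙-cong : ∀ {x x′ y y′} → Setoid._≈_ (E s) x x′ → Setoid._≈_ (E t) y y′ →
                   Setoid._≈_ (E u) (x ∙ y) (x′ ∙ y′)) where

  computableOp : (N : ∀ s → Numbering (E s)) → Effective (N s) (N t) (N u) _∙_ →
                 ComputableOp (λ s → fromNumbering (N s)) (binary E s t u _∙_ ∙-cong)
  computableOp N (tracked F F≈) = record
    { f̂ = record
        { code     = code F
        ; value    = λ xs _ → _
        ; computes = λ xs _ → computes F xs
        ; value∈   = _
        }
    ; commutes = λ xs _ → F≈ xs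
    }

  effective : (j : ∀ s → Indexing (E s)) (e : ∀ s → Setoid.Carrier (E s)) →
              ComputableOp j (binary E s t u _∙_ ∙-cong) →
              Effective (numbering (j s) (e s)) (numbering (j t) (e t)) (numbering (j u) (e u)) _∙_
  effective j e o = record
    { index            = λ xs → proj₁ (result xs)
    ; index-computable = computable
        (comp₁ Ju.locateCode
          (comp₂ f̂.code (comp₁ (code Js.enum-computable) (proj zero))
                        (comp₁ (code Jt.enum-computable) (proj (suc zero)))))
        λ xs → ⇓comp₁
          (⇓comp₂ (⇓comp₁ (⇓proj zero) (computes Js.enum-computable _))
                  (⇓comp₁ (⇓proj (suc zero)) (computes Jt.enum-computable _))
                  (f̂.computes _ (in-dom xs)))
          (proj₁ (proj₂ (result xs)))
    ; correct          = λ xs →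
        Setoid.trans (E u) (proj₂ (proj₂ (result xs))) (commutes _ (in-dom xs))
    }
    where
    open ComputableOp o
    module f̂ = ComputableFn f̂
    module Js = Totalisation (j s) (e s)
    module Jt = Totalisation (j t) (e t)
    module Ju = Totalisation (j u) (e u)

    in-dom : ∀ (xs : Vec ℕ 2) →
             (Js.enum (lookup xs zero) ∷ Jt.enum (lookup xs (suc zero)) ∷ [])
               ∈ ∏ (λ k → Indexing.dom (j (lookup (s ∷ t ∷ []) k)))
    in-dom xs zero       = Js.enum∈dom _
    in-dom xs (suc zero) = Jt.enum∈dom _

    result = λ xs → Ju.locate (f̂.value _ (in-dom xs)) (f̂.value∈ _ (in-dom xs))

module FiniteExtension {c ℓ} {K L : Field c ℓ} (ext : Extension K L) (fin : FiniteDegree ext) where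

  open Extension ext
  open FiniteDegree fin
  private
    module K = Field K
    module L = Field L
    module K+ = GroupProperties K.+-group
    module L+ = GroupProperties L.+-group
    module ι = RingMorphisms.IsRingMonomorphism isRingMonomorphism
  open SemiringSum L.semiring using (sum; sum-cong-≋; ∑-distrib-+; *-distribˡ-sum; *-distribʳ-sum)
  open SetoidReasoning L.setoid

  ·-cong : ∀ {a b x y} → a K.≈ b → x L.≈ y → a · x L.≈ b · y
  ·-cong a≈b = L.*-cong (⟦⟧-cong a≈b)

  linComb-cong : ∀ {as bs : Fin n → K.Carrier} {vs ws : Fin n → L.Carrier} →
                 (∀ i → as i K.≈ bs i) → (∀ i → vs i L.≈ ws i) →
                 linComb as vs L.≈ linComb bs ws
  linComb-cong as≈bs vs≈ws = sum-cong-≋ λ i → ·-cong (as≈bs i) (vs≈ws i)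

  linComb-+ : ∀ (as bs : Fin n → K.Carrier) vs →
              linComb (λ i → as i K.+ bs i) vs L.≈ linComb as vs L.+ linComb bs vs
  linComb-+ as bs vs = begin
    sum (λ i → ι (as i K.+ bs i) L.* vs i)
      ≈⟨ sum-cong-≋ (λ i → L.*-congʳ (ι.+-homo (as i) (bs i))) ⟩
    sum (λ i → (ι (as i) L.+ ι (bs i)) L.* vs i)
      ≈⟨ sum-cong-≋ (λ i → L.distribʳ (vs i) (ι (as i)) (ι (bs i))) ⟩
    sum (λ i → as i · vs i L.+ bs i · vs i)
      ≈⟨ ∑-distrib-+ (λ i → as i · vs i) (λ i → bs i · vs i) ⟩
    linComb as vs L.+ linComb bs vs
      ∎

  linComb-* : ∀ a (bs : Fin n → K.Carrier) vs →
              linComb (λ i → a K.* bs i) vs L.≈ a · linComb bs vs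
  linComb-* a bs vs = begin
    sum (λ i → ι (a K.* bs i) L.* vs i)
      ≈⟨ sum-cong-≋ (λ i → L.*-congʳ (ι.*-homo a (bs i))) ⟩
    sum (λ i → (ι a L.* ι (bs i)) L.* vs i)
      ≈⟨ sum-cong-≋ (λ i → L.*-assoc (ι a) (ι (bs i)) (vs i)) ⟩
    sum (λ i → a · (bs i · vs i))
      ≈⟨ *-distribˡ-sum (ι a) (λ i → bs i · vs i) ⟨
    a · linComb bs vs
      ∎

  linComb-product : ∀ (as bs : Fin n → K.Carrier) vs →
                    linComb as (λ i → linComb bs (λ j → vs i L.* vs j)) L.≈
                    linComb as vs L.* linComb bs vs
  linComb-product as bs vs = begin
    sum (λ i → as i · sum (λ j → bs j · (vs i L.* vs j)))
      ≈⟨ sum-cong-≋ (λ i → L.*-congˡ (sum-cong-≋ λ j → swap (ι (bs j)) (vs i) (vs j))) ⟩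
    sum (λ i → as i · sum (λ j → vs i L.* (bs j · vs j)))
      ≈⟨ sum-cong-≋ (λ i → L.*-congˡ (*-distribˡ-sum (vs i) (λ j → bs j · vs j))) ⟨
    sum (λ i → as i · (vs i L.* linComb bs vs))
      ≈⟨ sum-cong-≋ (λ i → L.*-assoc (ι (as i)) (vs i) (linComb bs vs)) ⟨
    sum (λ i → (as i · vs i) L.* linComb bs vs)
      ≈⟨ *-distribʳ-sum (linComb bs vs) (λ i → as i · vs i) ⟨
    linComb as vs L.* linComb bs vs
      ∎
    where
    swap : ∀ x y z → x L.* (y L.* z) L.≈ y L.* (x L.* z)
    swap x y z = L.trans (L.sym (L.*-assoc x y z))
      (L.trans (L.*-congʳ (L.*-comm x y)) (L.*-assoc y x z))

  coefficients-unique : ∀ as bs → linComb as basis L.≈ linComb bs basis → ∀ i → as i K.≈ bs i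
  coefficients-unique as bs as≈bs i =
    K+.x∙y⁻¹≈ε⇒x≈y (as i) (bs i) (independent difference difference≈0 i)
    where
    difference = λ i → as i K.- bs i

    difference≈0 : linComb difference basis L.≈ L.0#
    difference≈0 = L+.identityˡ-unique _ (linComb bs basis) (begin
      linComb difference basis L.+ linComb bs basis
        ≈⟨ linComb-+ difference bs basis ⟨
      linComb (λ i → difference i K.+ bs i) basis
        ≈⟨ linComb-cong (λ i → K+.//-rightDividesˡ (bs i) (as i)) (λ _ → L.refl) ⟩
      linComb as basis
        ≈⟨ as≈bs ⟩
      linComb bs basis
        ∎)

  tracked-linComb : ∀ {NK : Numbering K.setoid} {NL : Numbering L.setoid} →
                    Effective NL NL NL L._+_ → Effective NK NL NL _·_ →
                    ∀ {as : Fin n → Vec ℕ m → K.Carrier} {vs : Fin n → Vec ℕ m → L.Carrier} →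
                    (∀ i → Tracked NK (as i)) → (∀ i → Tracked NL (vs i)) →
                    Tracked NL λ xs → linComb (λ i → as i xs) (λ i → vs i xs)
  tracked-linComb {n = zero}  {NL = NL} add scale as vs = tracked-const NL L.0#
  tracked-linComb {n = suc n} add scale as vs =
    tracked-op L.+-cong add (tracked-op ·-cong scale (as zero) (vs zero))
      (tracked-linComb add scale (as ∘ suc) (vs ∘ suc))

  module Coordinates (NK : Numbering K.setoid) where

    private module NK = Numbering NK

    coordinate : Fin degree → ℕ → K.Carrier
    coordinate i z = NK.ν (decode i z)

    tracked-coordinate : ∀ i {Z : Vec ℕ m → ℕ} → Computable Z →
                         Tracked NK λ xs → coordinate i (Z xs)
    tracked-coordinate i Z = tracked-index NK (apply₁ (decode-computable i) Z)

    value : ℕ → L.Carrier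
    value z = linComb (λ i → coordinate i z) basis

    value-encode : ∀ (as : Fin degree → ℕ) → value (encode degree as) L.≈ linComb (NK.ν ∘ as) basis
    value-encode as =
      linComb-cong (λ i → K.reflexive (cong NK.ν (decode-encode as i))) (λ _ → L.refl)

    value-surjective : ∀ l → ∃ λ z → value z L.≈ l
    value-surjective l =
      let ks , l≈ = spanning l
      in encode degree (λ i → proj₁ (NK.surjective (ks i))) ,
         L.trans (value-encode _)
           (L.trans (linComb-cong (λ i → proj₂ (NK.surjective (ks i))) (λ _ → L.refl)) (L.sym l≈))

    numberingL : Numbering L.setoid
    numberingL = record
      { ν             = value
      ; surjective    = value-surjective
      ; eq            = λ xs → all degree λ i →
          NK.eq (decode i (lookup xs zero) ∷ decode i (lookup xs (suc zero)) ∷ [])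
      ; eq-computable = all-computable degree λ i → apply₂ NK.eq-computable
          (apply₁ (decode-computable i) (proj-computable zero))
          (apply₁ (decode-computable i) (proj-computable (suc zero)))
      ; eq-decides    = λ xs → decides-map
          (λ as≈bs → linComb-cong as≈bs (λ _ → L.refl)) (coefficients-unique _ _)
          (all-decides degree λ i → NK.eq-decides _)
      }

    tracked-tuple : ∀ {as : Fin degree → Vec ℕ m → K.Carrier} → (∀ i → Tracked NK (as i)) →
                    Tracked numberingL λ xs → linComb (λ i → as i xs) basis
    tracked-tuple as = tracked
      (encode-computable degree (Tracked.index-computable ∘ as))
      (λ xs → L.trans (value-encode _)
        (linComb-cong (λ i → Tracked.correct (as i) xs) (λ _ → L.refl)))

    module _ (+-effective : Effective NK NK NK K._+_) (*-effective : Effective NK NK NK K._*_) where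

      +L-effective : Effective numberingL numberingL numberingL L._+_
      +L-effective = tracked-resp numberingL (λ _ → linComb-+ _ _ basis)
        (tracked-tuple λ i → tracked-op K.+-cong +-effective
          (tracked-coordinate i (proj-computable zero))
          (tracked-coordinate i (proj-computable (suc zero))))

      ·-effective : Effective NK numberingL numberingL _·_
      ·-effective = tracked-resp numberingL (λ _ → linComb-* _ _ basis)
        (tracked-tuple λ i → tracked-op K.*-cong *-effective
          (tracked-index NK (proj-computable zero))
          (tracked-coordinate i (proj-computable (suc zero))))

      *L-effective : Effective numberingL numberingL numberingL L._*_
      *L-effective = tracked-resp numberingL (λ _ → linComb-product _ _ basis)
        (tracked-linComb +L-effective ·-effective
          (λ i → tracked-coordinate i (proj-computable zero))
          (λ i → tracked-linComb +L-effective ·-effective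
            (λ j → tracked-coordinate j (proj-computable (suc zero)))
            (λ j → tracked-const numberingL (basis i L.* basis j))))

  reductionL : ∀ {NK′ NK : Numbering K.setoid} {NL′ NL : Numbering L.setoid} →
               Effective NL′ NL′ NL′ L._+_ → Effective NK′ NL′ NL′ _·_ →
               Effective NL NL NL L._+_ → Effective NK NL NL _·_ →
               Reduction NK′ NK → Reduction NL′ NL
  reductionL {NK′} {NK} {NL′} {NL} add′ scale′ add scale r =
    let S , S-computable , S-correct = search NL′
          {f = λ xs → value (lookup xs zero)} {g = λ xs → NL′.ν (lookup xs (suc zero))}
          (tracked-linComb add′ scale′
            (λ i → tracked-coordinate i (proj-computable zero))
            (λ i → tracked-const NL′ (basis i)))
          (tracked-index NL′ (proj-computable (suc zero)))
          (λ { (x ∷ []) → value-surjective (NL′.ν x) })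
    in tracked-resp NL (λ { (x ∷ []) → S-correct (x ∷ []) })
         (tracked-linComb add scale
           (λ i → tracked-reduce r (tracked-coordinate i S-computable))
           (λ i → tracked-const NL (basis i)))
    where
    open Coordinates NK′
    module NL′ = Numbering NL′

module _ {c ℓ} (K : Field c ℓ) where

  private module K = Field K

  fieldAdmissible : (N : Numbering K.setoid) →
                    Effective N N N K._+_ → Effective N N N K._*_ →
                    AdmissibleIndexing (fieldStructure K)
  fieldAdmissible N add mul = record
    { indexing   = λ _ → fromNumbering N
    ; admissible = λ
        { zero       → computableOp zero zero zero K._+_ K.+-cong (λ _ → N) add
        ; (suc zero) → computableOp zero zero zero K._*_ K.*-cong (λ _ → N) mul
        }
    }

proposition10 : ∀ {c ℓ} (K L : Field c ℓ) (ext : Extension K L) →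
    FiniteDegree ext →
    Stable (fieldStructure K) →
    Stable (extensionStructure ext)
proposition10 K L ext fin stable = record
  { existence  = record
      { indexing   = λ s → fromNumbering (N s)
      ; admissible = λ
          { zero                         → computableOp k k k K._+_ K.+-cong N +K
          ; (suc zero)                   → computableOp k k k K._*_ K.*-cong N *K
          ; (suc (suc zero))             → computableOp l l l L._+_ L.+-cong N (+L-effective +K *K)
          ; (suc (suc (suc zero)))       → computableOp k l l _·_ ·-cong N (·-effective +K *K)
          ; (suc (suc (suc (suc zero)))) → computableOp l l l L._*_ L.*-cong N (*L-effective +K *K)
          }
      }
  ; uniqueness = λ j j′ → λ
      { zero       → reducesTo _ _ K.0# (reductionK j j′)
      ; (suc zero) → reducesTo _ _ L.0# (reductionL
          {NK′ = NK j′} {NK j}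
          (+L j′) (·L j′) (+L j) (·L j) (reductionK j j′))
      }
  }
  where
  module K = Field K
  module L = Field L
  open FiniteExtension ext fin
  open Extension ext
  open Stable stable
  open Structure (extensionStructure ext) using (E)
  open AdmissibleIndexing

  pattern k = zero
  pattern l = suc zero

  e : ∀ s → Setoid.Carrier (E s)
  e k = K.0#
  e l = L.0#

  module _ (j : AdmissibleIndexing (extensionStructure ext)) where

    NK = numbering (indexing j k) K.0#
    NL = numbering (indexing j l) L.0#

    NK-admissible : AdmissibleIndexing (fieldStructure K)
    NK-admissible = fieldAdmissible K NK
      (effective k k k K._+_ K.+-cong (indexing j) e (admissible j zero))
      (effective k k k K._*_ K.*-cong (indexing j) e (admissible j (suc zero)))

    +L : Effective NL NL NL L._+_
    +L = effective l l l L._+_ L.+-cong (indexing j) e (admissible j (suc (suc zero)))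

    ·L : Effective NK NL NL _·_
    ·L = effective k l l _·_ ·-cong (indexing j) e (admissible j (suc (suc (suc zero))))

  reductionK : ∀ j j′ → Reduction (NK j′) (NK j)
  reductionK j j′ = reduction (uniqueness (NK-admissible j) (NK-admissible j′) zero)

  K₀ : Fin 1 → K.Carrier
  K₀ _ = K.0#

  NK₀ = numbering (indexing existence zero) K.0#
  open Coordinates NK₀

  +K : Effective NK₀ NK₀ NK₀ K._+_
  +K = effective k k k K._+_ K.+-cong (indexing existence) K₀ (admissible existence zero)

  *K : Effective NK₀ NK₀ NK₀ K._*_
  *K = effective k k k K._*_ K.*-cong (indexing existence) K₀ (admissible existence (suc zero))

  N : ∀ s → Numbering (E s)
  N k = NK₀
  N l = numberingL
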